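{- Let $n\ge 1$ be an integer. If $\{H_1,\dots,H_m\}$ is a set of $m$ mutually unbiased Bush-type Hadamard matrices of order $4n^2$, then $m\le 2n-1$.
   Context: $J_k$ denotes the all-ones matrix of order $k$. A Hadamard matrix of order $k$ is a $k\times k$ matrix with entries in $\{ -1,1\}$ and pairwise orthogonal rows. Two Hadamard matrices $H,K$ of order $k$ are unbiased if $HK^t=\sqrt{k}\,L$ for some Hadamard matrix $L$; a set of Hadamard matrices is mutually unbiased if any two distinct members are unbiased. A Bush-type Hadamard matrix of order $4n^2$ is a Hadamard matrix $H=[H_{ij}]_{1\le i,j\le 2n}$ of order $4n^2$, partitioned into $2n\times 2n$ blocks $H_{ij}$, such that $H_{ii}=J_{2n}$ for all $i$ and $H_{ij}J_{2n}=J_{2n}H_{ij}=0$ for all $i\neq j$. -}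

module Defs where

open import Data.Nat.Base as ℕ using (ℕ)
open import Data.Integer.Base using (ℤ; +_; 0ℤ; 1ℤ; -1ℤ; _*_)
open import Data.Integer.Properties using (+-*-semiring)
open import Data.Fin.Base using (Fin; combine)
open import Data.Product.Base using (_×_; ∃-syntax)
open import Data.Sum.Base using (_⊎_)
open import Relation.Binary.PropositionalEquality.Core using (_≡_; _≢_)
open import Algebra.Properties.Semiring.Sum +-*-semiring using (sum-syntax)

Matrix : ℕ → Set
Matrix k = Fin k → Fin k → ℤ

infix 4 _≋_
infixl 7 _⊗_
infixr 7 _·_
infix 8 _ᵗ

_≋_ : ∀ {k} → Matrix k → Matrix k → Set
A ≋ B = ∀ i j → A i j ≡ B i j

_⊗_ : ∀ {k} → Matrix k → Matrix k → Matrix k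
_⊗_ {k} A B i j = ∑[ l < k ] (A i l * B l j)

_·_ : ∀ {k} → ℤ → Matrix k → Matrix k
(c · A) i j = c * A i j

_ᵗ : ∀ {k} → Matrix k → Matrix k
(A ᵗ) i j = A j i

J : ∀ k → Matrix k
J k _ _ = 1ℤ

O : ∀ k → Matrix k
O k _ _ = 0ℤ

record IsHadamard {k : ℕ} (H : Matrix k) : Set where
  field
    entries    : ∀ i j → H i j ≡ 1ℤ ⊎ H i j ≡ -1ℤ
    orthogonal : ∀ i j → i ≢ j → ∑[ l < k ] (H i l * H j l) ≡ 0ℤ

-- H Kᵗ = √k L.  The natural number s is √k.  Requiring √k to be a natural
-- number loses nothing: for k ≥ 1 the entries of H Kᵗ are integers and those
-- of L are ±1, so the equation itself forces √k to be an integer.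
Unbiased : ∀ {k} → Matrix k → Matrix k → Set
Unbiased {k} H K =
  ∃[ s ] (s ℕ.* s ≡ k × ∃[ L ] (IsHadamard L × H ⊗ K ᵗ ≋ + s · L))

-- A set of m matrices is given as a family indexed by Fin m.  In order k ≥ 2
-- a Hadamard matrix is not unbiased with itself (H Hᵗ = k I has zero entries),
-- so the members of such a family are automatically distinct.
MutuallyUnbiased : ∀ {m k} → (Fin m → Matrix k) → Set
MutuallyUnbiased H = ∀ i j → i ≢ j → Unbiased (H i) (H j)

-- The (i , j) block of size b × b: combine i a has value i · b + a.
block : ∀ {b} → Matrix (b ℕ.* b) → Fin b → Fin b → Matrix b
block H i j a c = H (combine i a) (combine j c)

-- The order 4n² is written (2n)(2n), i.e. 2n blocks of size 2n.
record IsBushType (n : ℕ) (H : Matrix ((2 ℕ.* n) ℕ.* (2 ℕ.* n))) : Set where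
  field
    hadamard : IsHadamard H
    diagonal : ∀ i → block H i i ≋ J (2 ℕ.* n)
    rowSums  : ∀ i j → i ≢ j → block H i j ⊗ J (2 ℕ.* n) ≋ O (2 ℕ.* n)
    colSums  : ∀ i j → i ≢ j → J (2 ℕ.* n) ⊗ block H i j ≋ O (2 ℕ.* n)

{-# OPTIONS --safe #-}

-- Put b = 2n and fix a block row i and a coordinate x = (j , c) with j ≠ i.
-- For each H_l let g_l be b² times the projection of e_x onto the span of the
-- rows of H_l in block row i, that is, g_l = Σ_a H_l(ia , x) H_l(ia , -).  The
-- rows of H_l and H_l′ in block row i have all inner products equal to b: they
-- are ±b, and they have average b since the off-diagonal blocks have zero column
-- sums.  The column Σ_a H_l(ia , x) is zero, so g_l and g_l′ are orthogonal.
-- All g_l are also orthogonal to b times the indicator vector of block column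
-- j, because the off-diagonal blocks have zero row sums.  These m + 1 vectors
-- have squared norm b³ and x-coordinate b, so Bessel's inequality for e_x
-- gives m + 1 ≤ b.
module Submission where

open import Defs
open import Data.Nat.Base using (ℕ; _*_; _∸_; _≤_)
open import Data.Fin.Base using (Fin)
open import Data.Bool.Base using (if_then_else_)
open import Data.Fin.Base using (zero; suc; combine; quotient; _↑ˡ_; _↑ʳ_)
open import Data.Fin.Properties using (_≟_; punchInᵢ≢i; remQuot-combine; combine-injectiveʳ)
open import Data.Integer.Base as ℤ using (ℤ; +_; 0ℤ; 1ℤ; -1ℤ; +≤+)
open import Data.Integer.Properties as ℤ using (+-*-semiring)
import Data.Nat.Base as ℕ
import Data.Nat.Properties as ℕ
open import Data.Product.Base using (∃₂; _,_; proj₁; proj₂)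
open import Data.Sum.Base using (_⊎_; inj₁; inj₂)
open import Data.Vec.Functional using (removeAt)
open import Function.Base using (_∘_)
open import Relation.Binary.Definitions using (tri<; tri≈; tri>)
open import Relation.Binary.PropositionalEquality using (_≡_; _≢_; refl; sym; trans; cong; cong₂; subst; module ≡-Reasoning)
open import Relation.Nullary.Decidable using (does; dec-true; dec-false)
open import Relation.Nullary.Negation using (contradiction)
open import Algebra.Properties.Semiring.Sum +-*-semiring using (sum; sum-syntax; sum-remove; sum-cong-≗; sum-replicate-zero; ∑-distrib-+; ∑-comm; *-distribˡ-sum; *-distribʳ-sum)

-- Finite sums of integers

sum-zero : ∀ {n} {f : Fin n → ℤ} → (∀ i → f i ≡ 0ℤ) → sum f ≡ 0ℤ
sum-zero {n} f≡0 = trans (sum-cong-≗ f≡0) (sum-replicate-zero n)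

sum-const : ∀ n x → ∑[ i < n ] x ≡ + n ℤ.* x
sum-const ℕ.zero    x = sym (ℤ.*-zeroˡ x)
sum-const (ℕ.suc n) x = begin
  x ℤ.+ sum {n} (λ _ → x)    ≡⟨ cong₂ ℤ._+_ (sym (ℤ.*-identityˡ x)) (sum-const n x) ⟩
  1ℤ ℤ.* x ℤ.+ + n ℤ.* x     ≡⟨ ℤ.*-distribʳ-+ x 1ℤ (+ n) ⟨
  + ℕ.suc n ℤ.* x            ∎
  where open ≡-Reasoning

sum-single : ∀ {n} (f : Fin n → ℤ) i → (∀ j → j ≢ i → f j ≡ 0ℤ) → sum f ≡ f i
sum-single {ℕ.suc n} f i f≡0 = begin
  sum f                                ≡⟨ sum-remove {i = i} f ⟩
  f i ℤ.+ sum (removeAt f i)           ≡⟨ cong (ℤ._+_ (f i)) (sum-zero (λ j → f≡0 _ (punchInᵢ≢i i j))) ⟩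
  f i ℤ.+ 0ℤ                           ≡⟨ ℤ.+-identityʳ (f i) ⟩
  f i                                  ∎
  where open ≡-Reasoning

sum-++ : ∀ m {n} (f : Fin (m ℕ.+ n) → ℤ) →
         sum f ≡ ∑[ i < m ] f (i ↑ˡ n) ℤ.+ ∑[ j < n ] f (m ↑ʳ j)
sum-++ ℕ.zero    f = sym (ℤ.+-identityˡ _)
sum-++ (ℕ.suc m) f =
  trans (cong (ℤ._+_ (f zero)) (sum-++ m (f ∘ suc))) (sym (ℤ.+-assoc (f zero) _ _))

sum-combine : ∀ m {n} (f : Fin (m * n) → ℤ) →
              sum f ≡ ∑[ i < m ] ∑[ j < n ] f (combine i j)
sum-combine ℕ.zero        f = refl
sum-combine (ℕ.suc m) {n} f =
  trans (sum-++ n f) (cong (ℤ._+_ (∑[ j < n ] f (j ↑ˡ m * n))) (sum-combine m (f ∘ (n ↑ʳ_))))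

sum-nonNeg : ∀ {n} {f : Fin n → ℤ} → (∀ i → 0ℤ ℤ.≤ f i) → 0ℤ ℤ.≤ sum f
sum-nonNeg {ℕ.zero}  0≤f = ℤ.≤-refl
sum-nonNeg {ℕ.suc n} 0≤f = ℤ.+-mono-≤ (0≤f zero) (sum-nonNeg (0≤f ∘ suc))

term≤sum : ∀ {n} {f : Fin n → ℤ} → (∀ i → 0ℤ ℤ.≤ f i) → ∀ i → f i ℤ.≤ sum f
term≤sum {f = f} 0≤f zero =
  subst (ℤ._≤ sum f) (ℤ.+-identityʳ (f zero)) (ℤ.+-monoʳ-≤ (f zero) (sum-nonNeg (0≤f ∘ suc)))
term≤sum {f = f} 0≤f (suc i) =
  subst (ℤ._≤ sum f) (ℤ.+-identityˡ (f (suc i))) (ℤ.+-mono-≤ (0≤f zero) (term≤sum (0≤f ∘ suc) i))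

-- The gaps `c ℤ.- f i` are nonnegative and add up to zero, so each gap, being at most the sum of
-- all of them, is at most zero.
sum-tight : ∀ {n c} (f : Fin n → ℤ) → (∀ i → f i ℤ.≤ c) → sum f ≡ + n ℤ.* c → ∀ i → f i ≡ c
sum-tight {n} {c} f f≤c eq i = ℤ.≤-antisym (f≤c i) (ℤ.i-j≤0⇒i≤j (begin
  c ℤ.- f i                    ≤⟨ term≤sum (ℤ.i≤j⇒0≤j-i ∘ f≤c) i ⟩
  sum (λ k → c ℤ.- f k)        ≡⟨ sum-cong-≗ (λ k → cong (ℤ._+_ c) (sym (ℤ.-1*i≡-i (f k)))) ⟩
  sum (λ k → c ℤ.+ -1ℤ ℤ.* f k)
    ≡⟨ ∑-distrib-+ (λ _ → c) (λ k → -1ℤ ℤ.* f k) ⟩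
  sum {n} (λ _ → c) ℤ.+ sum (λ k → -1ℤ ℤ.* f k)
    ≡⟨ cong₂ ℤ._+_ (sum-const n c) (sym (*-distribˡ-sum -1ℤ f)) ⟩
  + n ℤ.* c ℤ.+ -1ℤ ℤ.* sum f  ≡⟨ cong (ℤ._+_ (+ n ℤ.* c)) (trans (ℤ.-1*i≡-i (sum f)) (cong ℤ.-_ eq)) ⟩
  + n ℤ.* c ℤ.- + n ℤ.* c      ≡⟨ ℤ.+-inverseʳ (+ n ℤ.* c) ⟩
  0ℤ                           ∎))
  where open ℤ.≤-Reasoning

-- Inner products and linear combinations

infix 7 _∙_

_∙_ : ∀ {k} → (Fin k → ℤ) → (Fin k → ℤ) → ℤ
_∙_ {k} u v = ∑[ y < k ] (u y ℤ.* v y)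

∙-comm : ∀ {k} (u v : Fin k → ℤ) → u ∙ v ≡ v ∙ u
∙-comm u v = sum-cong-≗ (λ y → ℤ.*-comm (u y) (v y))

lincomb : ∀ {m k} → (Fin m → ℤ) → (Fin m → Fin k → ℤ) → Fin k → ℤ
lincomb {m} h v y = ∑[ a < m ] (h a ℤ.* v a y)

∙-lincombˡ : ∀ {m k} (h : Fin m → ℤ) (v : Fin m → Fin k → ℤ) (w : Fin k → ℤ) →
             lincomb h v ∙ w ≡ ∑[ a < m ] (h a ℤ.* (v a ∙ w))
∙-lincombˡ {m} {k} h v w = begin
  ∑[ y < k ] (lincomb h v y ℤ.* w y)
    ≡⟨ sum-cong-≗ (λ y → *-distribʳ-sum (w y) (λ a → h a ℤ.* v a y)) ⟩
  ∑[ y < k ] ∑[ a < m ] (h a ℤ.* v a y ℤ.* w y)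
    ≡⟨ ∑-comm (λ y a → h a ℤ.* v a y ℤ.* w y) ⟩
  ∑[ a < m ] ∑[ y < k ] (h a ℤ.* v a y ℤ.* w y)
    ≡⟨ sum-cong-≗ (λ a → sum-cong-≗ (λ y → ℤ.*-assoc (h a) (v a y) (w y))) ⟩
  ∑[ a < m ] ∑[ y < k ] (h a ℤ.* (v a y ℤ.* w y))
    ≡⟨ sum-cong-≗ (λ a → *-distribˡ-sum (h a) (λ y → v a y ℤ.* w y)) ⟨
  ∑[ a < m ] (h a ℤ.* (v a ∙ w))
    ∎
  where open ≡-Reasoning

∙-lincombʳ : ∀ {m k} (w : Fin k → ℤ) (h : Fin m → ℤ) (v : Fin m → Fin k → ℤ) →
             w ∙ lincomb h v ≡ ∑[ a < m ] (h a ℤ.* (w ∙ v a))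
∙-lincombʳ w h v = trans (∙-comm w (lincomb h v)) (trans (∙-lincombˡ h v w)
  (sum-cong-≗ (λ a → cong (h a ℤ.*_) (∙-comm (v a) w))))

0≤i*i : ∀ i → 0ℤ ℤ.≤ i ℤ.* i
0≤i*i (+ n)        = subst (0ℤ ℤ.≤_) (ℤ.pos-* n n) (+≤+ ℕ.z≤n)
0≤i*i ℤ.-[1+ n ]   = +≤+ ℕ.z≤n

-- Bessel's inequality for the coordinate vector e_x.
orthogonal-count : ∀ {N k} c t .{{_ : ℕ.NonZero c}} (x : Fin k) (g : Fin N → Fin k → ℤ) →
  (∀ i j → i ≢ j → g i ∙ g j ≡ 0ℤ) →
  (∀ i → g i ∙ g i ≡ + (c * t)) →
  (∀ i → g i x ≡ + c) →
  N * c ≤ t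
orthogonal-count {ℕ.zero}      c t x g orth norm val = ℕ.z≤n
orthogonal-count {N@(ℕ.suc _)} c t x g orth norm val =
  -- By orthogonality the sum `u` of all `g i` has `u ∙ u` equal to `N * (c * t)`, and this bounds
  -- the single square `u x ℤ.* u x`, where `u x` is `N * c`. Cancelling `N * c` requires it to be
  -- nonzero, hence the separate case of an empty family.
  ℕ.*-cancelˡ-≤ (N * c) {{ℕ.m*n≢0 N c}} (ℤ.drop‿+≤+ (begin
    + (N * c * (N * c))    ≡⟨ ℤ.pos-* (N * c) (N * c) ⟩
    + (N * c) ℤ.* + (N * c)  ≡⟨ cong₂ ℤ._*_ ux ux ⟨
    u x ℤ.* u x            ≤⟨ term≤sum (λ y → 0≤i*i (u y)) x ⟩
    u ∙ u                  ≡⟨ ∙-lincombˡ (λ _ → 1ℤ) g u ⟩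
    sum (λ i → 1ℤ ℤ.* (g i ∙ u))
      ≡⟨ sum-cong-≗ (λ i → trans (ℤ.*-identityˡ (g i ∙ u)) (g∙u i)) ⟩
    sum {N} (λ _ → + (c * t))  ≡⟨ sum-const N (+ (c * t)) ⟩
    + N ℤ.* + (c * t)      ≡⟨ ℤ.pos-* N (c * t) ⟨
    + (N * (c * t))        ≡⟨ cong +_ (ℕ.*-assoc N c t) ⟨
    + (N * c * t)          ∎))
  where
  open ℤ.≤-Reasoning
  u = lincomb (λ _ → 1ℤ) g
  ux : u x ≡ + (N * c)
  ux = trans (sum-cong-≗ (λ i → trans (ℤ.*-identityˡ (g i x)) (val i)))
         (trans (sum-const N (+ c)) (sym (ℤ.pos-* N c)))
  g∙u : ∀ i → g i ∙ u ≡ + (c * t)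
  g∙u i = trans (∙-lincombʳ (g i) (λ _ → 1ℤ) g) (trans
    (sum-single _ i (λ j j≢i → trans (ℤ.*-identityˡ _) (orth i j (j≢i ∘ sym))))
    (trans (ℤ.*-identityˡ _) (norm i)))

-- The value `+ b` gives this vector the same squared norm and the same entry at `x` as the
-- projections, so that `orthogonal-count` can treat them all alike.
scaledIndicator : ∀ {b} → Fin b → Fin (b * b) → ℤ
scaledIndicator {b} j y = if does (quotient {b} b y ≟ j) then + b else 0ℤ

scaledIndicator-in : ∀ {b} (j c : Fin b) → scaledIndicator j (combine j c) ≡ + b
scaledIndicator-in {b} j c = cong (λ t → if t then + b else 0ℤ)
  (dec-true (_ ≟ j) (cong proj₁ (remQuot-combine j c)))

scaledIndicator-out : ∀ {b} {i j : Fin b} c → i ≢ j → scaledIndicator j (combine i c) ≡ 0ℤ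
scaledIndicator-out {b} {i} {j} c i≢j = cong (λ t → if t then + b else 0ℤ)
  (dec-false (_ ≟ j) (i≢j ∘ trans (sym (cong proj₁ (remQuot-combine i c)))))

scaledIndicator-∙ : ∀ {b} (j : Fin b) w →
                   scaledIndicator j ∙ w ≡ + b ℤ.* (∑[ c < b ] w (combine j c))
scaledIndicator-∙ {b} j w = begin
  scaledIndicator j ∙ w
    ≡⟨ sum-combine b _ ⟩
  ∑[ i < b ] ∑[ c < b ] (scaledIndicator j (combine i c) ℤ.* w (combine i c))
    ≡⟨ sum-single _ j (λ i i≢j → sum-zero (λ c → cong (ℤ._* w (combine i c)) (scaledIndicator-out c i≢j))) ⟩
  ∑[ c < b ] (scaledIndicator j (combine j c) ℤ.* w (combine j c))
    ≡⟨ sum-cong-≗ (λ c → cong (ℤ._* w (combine j c)) (scaledIndicator-in j c)) ⟩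
  ∑[ c < b ] (+ b ℤ.* w (combine j c))
    ≡⟨ *-distribˡ-sum (+ b) (w ∘ combine j) ⟨
  + b ℤ.* (∑[ c < b ] w (combine j c))
    ∎
  where open ≡-Reasoning

-- Hadamard and Bush-type matrices

IsSign : ℤ → Set
IsSign x = x ≡ 1ℤ ⊎ x ≡ -1ℤ

sign-square : ∀ {x} → IsSign x → x ℤ.* x ≡ 1ℤ
sign-square (inj₁ refl) = refl
sign-square (inj₂ refl) = refl

sign-≤1 : ∀ {x} → IsSign x → x ℤ.≤ 1ℤ
sign-≤1 (inj₁ refl) = ℤ.≤-refl
sign-≤1 (inj₂ refl) = ℤ.-≤+

square-injective : ∀ {m n} → m * m ≡ n * n → m ≡ n
square-injective {m} {n} eq with ℕ.<-cmp m n
... | tri< m<n _ _ = contradiction eq (ℕ.<⇒≢ (ℕ.*-mono-< m<n m<n))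
... | tri≈ _ m≡n _ = m≡n
... | tri> _ _ n<m = contradiction (sym eq) (ℕ.<⇒≢ (ℕ.*-mono-< n<m n<m))

sum-square-signs : ∀ {k} {v : Fin k → ℤ} → (∀ y → IsSign (v y)) → v ∙ v ≡ + k
sum-square-signs {k} sgn = trans (sum-cong-≗ (sign-square ∘ sgn))
  (trans (sum-const k 1ℤ) (ℤ.*-identityʳ (+ k)))

-- The scalar in `Unbiased` must be `b`, since its square is `b * b`, and the entries of `L` are at
-- most 1. This upper bound is what `sum-tight` consumes.
unbiased-≤ : ∀ {b} (H K : Matrix (b * b)) → Unbiased H K → ∀ y z → H y ∙ K z ℤ.≤ + b
unbiased-≤ {b} H K (s , s²≡b² , L , hadL , HKᵗ≋sL) y z = begin
  H y ∙ K z       ≡⟨ HKᵗ≋sL y z ⟩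
  + s ℤ.* L y z   ≤⟨ ℤ.*-monoˡ-≤-nonNeg (+ s) (sign-≤1 (IsHadamard.entries hadL y z)) ⟩
  + s ℤ.* 1ℤ      ≡⟨ ℤ.*-identityʳ (+ s) ⟩
  + s             ≡⟨ cong +_ (square-injective s²≡b²) ⟩
  + b             ∎
  where open ℤ.≤-Reasoning

module BushType {n} {H : Matrix ((2 * n) * (2 * n))} (bush : IsBushType n H) where
  open IsBushType bush
  open IsHadamard hadamard

  b : ℕ
  b = 2 * n

  rows : Fin b → Fin b → Fin (b * b) → ℤ
  rows i a = H (combine i a)

  rowSum : ∀ {i j} a → i ≢ j → ∑[ c < b ] rows i a (combine j c) ≡ 0ℤ
  rowSum {i} {j} a i≢j = trans
    (sum-cong-≗ (λ c → sym (ℤ.*-identityʳ (rows i a (combine j c)))))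
    -- All columns of a product with `J` on the right agree, so the second `a` is an arbitrary
    -- column index.
    (rowSums i j i≢j a a)

  colSum : ∀ {i j} c → i ≢ j → ∑[ a < b ] rows i a (combine j c) ≡ 0ℤ
  colSum {i} {j} c i≢j = trans
    (sum-cong-≗ (λ a → sym (ℤ.*-identityˡ (rows i a (combine j c)))))
    (colSums i j i≢j c c)

  colSum-diagonal : ∀ i c → ∑[ a < b ] rows i a (combine i c) ≡ + b
  colSum-diagonal i c = trans (sum-cong-≗ (λ a → diagonal i a c))
    (trans (sum-const b 1ℤ) (ℤ.*-identityʳ (+ b)))

  -- The rows of block row `i` add up to `b` times the indicator of block column `i`: column sums
  -- are `b` in the diagonal block and 0 elsewhere. Hence only the `b` coordinates where `w` is 1
  -- contribute.
  sum-∙-rows : ∀ i w → (∀ c → w (combine i c) ≡ 1ℤ) → ∑[ a < b ] (w ∙ rows i a) ≡ + b ℤ.* + b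
  sum-∙-rows i w w≡1 = begin
    ∑[ a < b ] (w ∙ rows i a)
      ≡⟨ ∑-comm (λ a y → w y ℤ.* rows i a y) ⟩
    ∑[ y < b * b ] ∑[ a < b ] (w y ℤ.* rows i a y)
      ≡⟨ sum-cong-≗ (λ y → *-distribˡ-sum (w y) (λ a → rows i a y)) ⟨
    ∑[ y < b * b ] (w y ℤ.* (∑[ a < b ] rows i a y))
      ≡⟨ sum-combine b _ ⟩
    ∑[ j < b ] ∑[ c < b ] (w (combine j c) ℤ.* (∑[ a < b ] rows i a (combine j c)))
      ≡⟨ sum-single _ i (λ j j≢i → sum-zero (λ c →
           trans (cong (w (combine j c) ℤ.*_) (colSum c (j≢i ∘ sym))) (ℤ.*-zeroʳ (w (combine j c))))) ⟩
    ∑[ c < b ] (w (combine i c) ℤ.* (∑[ a < b ] rows i a (combine i c)))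
      ≡⟨ sum-cong-≗ (λ c →
           trans (cong₂ ℤ._*_ (w≡1 c) (colSum-diagonal i c)) (ℤ.*-identityˡ (+ b))) ⟩
    ∑[ c < b ] (+ b)
      ≡⟨ sum-const b (+ b) ⟩
    + b ℤ.* + b
      ∎
    where open ≡-Reasoning

  -- b² times the row x of the matrix of the orthogonal projection.
  projection : Fin b → Fin (b * b) → Fin (b * b) → ℤ
  projection i x = lincomb (λ a → rows i a x) (rows i)

  -- At `x` itself the combination unfolds to a sum of squares of `b` signs.
  projection-diagonal : ∀ i x → projection i x x ≡ + b
  projection-diagonal i x = sum-square-signs (λ a → entries (combine i a) x)

  -- The rows are pairwise orthogonal with squared norm `b * b`, so pairing with one row isolates
  -- its coefficient; the `b` coefficients are signs and square to 1.
  projection-norm : ∀ i x → projection i x ∙ projection i x ≡ + (b * (b * b))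
  projection-norm i x = begin
    projection i x ∙ projection i x
      ≡⟨ ∙-lincombˡ (λ a → rows i a x) (rows i) (projection i x) ⟩
    ∑[ a < b ] (rows i a x ℤ.* (rows i a ∙ projection i x))
      ≡⟨ sum-cong-≗ (λ a → cong (rows i a x ℤ.*_) (row∙projection a)) ⟩
    ∑[ a < b ] (rows i a x ℤ.* (rows i a x ℤ.* + (b * b)))
      ≡⟨ sum-cong-≗ (λ a → trans (sym (ℤ.*-assoc (rows i a x) (rows i a x) (+ (b * b))))
           (trans (cong (ℤ._* + (b * b)) (sign-square (entries (combine i a) x))) (ℤ.*-identityˡ _))) ⟩
    ∑[ a < b ] (+ (b * b))
      ≡⟨ sum-const b (+ (b * b)) ⟩
    + b ℤ.* + (b * b)
      ≡⟨ ℤ.pos-* b (b * b) ⟨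
    + (b * (b * b))
      ∎
    where
    open ≡-Reasoning
    row∙projection : ∀ a → rows i a ∙ projection i x ≡ rows i a x ℤ.* + (b * b)
    row∙projection a = trans (∙-lincombʳ (rows i a) (λ a′ → rows i a′ x) (rows i)) (trans
      (sum-single _ a (λ a′ a′≢a → trans
        (cong (rows i a′ x ℤ.*_) (orthogonal _ _ (a′≢a ∘ sym ∘ combine-injectiveʳ i a i a′)))
        (ℤ.*-zeroʳ (rows i a′ x))))
      (cong (rows i a x ℤ.*_) (sum-square-signs (entries (combine i a)))))

  -- Already each row of block row `i` is orthogonal to the indicator, because its entries in block
  -- column `j` sum to zero.
  indicator∙projection : ∀ {i j} x → i ≢ j → scaledIndicator j ∙ projection i x ≡ 0ℤ
  indicator∙projection {i} {j} x i≢j = trans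
    (∙-lincombʳ (scaledIndicator j) (λ a → rows i a x) (rows i))
    (sum-zero (λ a → trans
      (cong (rows i a x ℤ.*_) (trans (scaledIndicator-∙ j (rows i a))
        (trans (cong (+ b ℤ.*_) (rowSum a i≢j)) (ℤ.*-zeroʳ (+ b)))))
      (ℤ.*-zeroʳ (rows i a x))))

open BushType using (rows; colSum; sum-∙-rows; projection; projection-diagonal; projection-norm; indicator∙projection)

-- Pairs of unbiased Bush-type matrices

module _ {n} {H K : Matrix ((2 * n) * (2 * n))}
         (bushH : IsBushType n H) (bushK : IsBushType n K) (unbiased : Unbiased H K) where

  -- For fixed `a` there are `b` products, each at most `b` by unbiasedness, with total `b` squared
  -- because the diagonal block of `H` is all ones. So every one attains the bound.
  rows∙rows : ∀ i a c → rows bushH i a ∙ rows bushK i c ≡ + (2 * n)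
  rows∙rows i a = sum-tight _
    (λ c → unbiased-≤ H K unbiased (combine i a) (combine i c))
    (sum-∙-rows bushK i (rows bushH i a) (IsBushType.diagonal bushH i a))

  -- Since all products of rows equal `b`, pairing a row of `H` with the projection for `K` gives
  -- `b` times a column sum of the off-diagonal block `(i , j)` of `K`, which is zero.
  projection∙projection : ∀ {i j} c → i ≢ j →
    projection bushH i (combine j c) ∙ projection bushK i (combine j c) ≡ 0ℤ
  projection∙projection {i} {j} c i≢j = trans
    (∙-lincombˡ (λ a → rows bushH i a x) (rows bushH i) (projection bushK i x))
    (sum-zero (λ a → trans (cong (rows bushH i a x ℤ.*_) (row∙projection a)) (ℤ.*-zeroʳ (rows bushH i a x))))
    where
    x = combine j c
    row∙projection : ∀ a → rows bushH i a ∙ projection bushK i x ≡ 0ℤ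
    row∙projection a = begin
      rows bushH i a ∙ projection bushK i x
        ≡⟨ ∙-lincombʳ (rows bushH i a) (λ a′ → rows bushK i a′ x) (rows bushK i) ⟩
      ∑[ a′ < 2 * n ] (rows bushK i a′ x ℤ.* (rows bushH i a ∙ rows bushK i a′))
        ≡⟨ sum-cong-≗ (λ a′ → cong (rows bushK i a′ x ℤ.*_) (rows∙rows i a a′)) ⟩
      ∑[ a′ < 2 * n ] (rows bushK i a′ x ℤ.* + (2 * n))
        ≡⟨ *-distribʳ-sum (+ (2 * n)) (λ a′ → rows bushK i a′ x) ⟨
      (∑[ a′ < 2 * n ] rows bushK i a′ x) ℤ.* + (2 * n)
        ≡⟨ cong (ℤ._* + (2 * n)) (colSum bushK c i≢j) ⟩
      0ℤ
        ∎
      where open ≡-Reasoning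

twoDistinct : ∀ {b} → 2 ≤ b → ∃₂ λ (i j : Fin b) → i ≢ j
twoDistinct (ℕ.s≤s (ℕ.s≤s _)) = zero , suc zero , λ ()

mainTheorem3 : (n : ℕ) → 1 ≤ n → (m : ℕ) →
    (H : Fin m → Matrix ((2 * n) * (2 * n))) →
    (∀ i → IsBushType n (H i)) →
    MutuallyUnbiased H →
    m ≤ 2 * n ∸ 1
mainTheorem3 n 1≤n m H bush unbiased =
  -- Bessel with `c = b` and `t = b * b` yields `suc m * b ≤ b * b`; cancelling `b` leaves
  -- `suc m ≤ b`.
  ℕ.∸-monoˡ-≤ 1 (ℕ.*-cancelʳ-≤ (ℕ.suc m) b b (orthogonal-count b (b * b) x g orth norm val))
  where
  b = 2 * n
  -- From `1 ≤ n` there are at least two block indices, so an off-diagonal block exists.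
  2≤b : 2 ≤ b
  2≤b = ℕ.*-monoʳ-≤ 2 1≤n
  instance
    b≢0 : ℕ.NonZero b
    b≢0 = ℕ.>-nonZero (ℕ.≤-trans (ℕ.s≤s ℕ.z≤n) 2≤b)
  i = proj₁ (twoDistinct 2≤b)
  j = proj₁ (proj₂ (twoDistinct 2≤b))
  i≢j = proj₂ (proj₂ (twoDistinct 2≤b))
  -- Any coordinate in block column `j` would serve; the offset `j` within it is an arbitrary
  -- choice.
  x : Fin (b * b)
  x = combine j j

  -- The indicator at index `zero` is the extra vector that improves the bound from `2 * n` to
  -- `2 * n ∸ 1`.
  g : Fin (ℕ.suc m) → Fin (b * b) → ℤ
  g zero    = scaledIndicator j
  g (suc l) = projection (bush l) i x

  orth : ∀ k l → k ≢ l → g k ∙ g l ≡ 0ℤ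
  orth zero    zero    k≢l = contradiction refl k≢l
  orth zero    (suc l) _   = indicator∙projection (bush l) x i≢j
  orth (suc k) zero    _   = trans (∙-comm (g (suc k)) (g zero)) (indicator∙projection (bush k) x i≢j)
  orth (suc k) (suc l) k≢l =
    projection∙projection (bush k) (bush l) (unbiased k l (k≢l ∘ cong suc)) j i≢j

  norm : ∀ l → g l ∙ g l ≡ + (b * (b * b))
  norm zero    = begin
    scaledIndicator j ∙ scaledIndicator j
      ≡⟨ scaledIndicator-∙ j (scaledIndicator j) ⟩
    + b ℤ.* (∑[ c < b ] scaledIndicator j (combine j c))
      ≡⟨ cong (+ b ℤ.*_) (trans (sum-cong-≗ (scaledIndicator-in j)) (sum-const b (+ b))) ⟩
    + b ℤ.* (+ b ℤ.* + b)
      ≡⟨ trans (ℤ.pos-* b (b * b)) (cong (+ b ℤ.*_) (ℤ.pos-* b b)) ⟨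
    + (b * (b * b))
      ∎
    where open ≡-Reasoning
  norm (suc l) = projection-norm (bush l) i x

  val : ∀ l → g l x ≡ + b
  val zero    = scaledIndicator-in j j
  val (suc l) = projection-diagonal (bush l) i x
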